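{- For every integer $d\ge 1$ with $d\ne 3$, the $d$-cube is strongly $\lfloor (d+1)/2\rfloor$-linked.
   Context: A $d$-polytope $P$ is strongly $\lfloor (d+1)/2\rfloor$-linked if its graph (vertices and edges of $P$) has at least $d+1$ vertices and, for every set $X$ of exactly $d+1$ vertices and every labelling and pairing $Y=\{\{s_1,t_1\},\dots,\{s_k,t_k\}\}$, $k=\lfloor (d+1)/2\rfloor$, of $2k$ vertices of $X$, there exist pairwise vertex-disjoint paths $L_i$ joining $s_i$ and $t_i$ ($i=1,\dots,k$) in the graph of $P$ such that no path $L_i$ contains a vertex of $X$ that is not paired in $Y$. -}

module Defs where

open import Level using (Level; _⊔_)
open import Data.Nat using (ℕ; suc; _+_; _≤_; ⌊_/2⌋)
open import Data.Bool using (Bool; true; false; if_then_else_)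
open import Data.Fin using (Fin)
open import Data.Vec using (Vec; []; _∷_)
open import Data.List using (List; []; _∷_)
open import Data.List.Relation.Unary.Unique.Propositional using (Unique)
open import Data.List.Membership.Propositional using (_∈_)
open import Data.Product using (Σ; ∃; _×_; _,_)
open import Relation.Binary.PropositionalEquality using (_≡_; _≢_)
open import Relation.Nullary using (¬_)
open import Function.Definitions using (Injective)

data Walk {a e : Level} {V : Set a} (E : V → V → Set e) : V → V → List V → Set (a ⊔ e) where
  stop : (v : V) → Walk E v v (v ∷ [])
  step : {u w v : V} {vs : List V} → E u w → Walk E w v vs → Walk E u v (u ∷ vs)

IsPath : {a e : Level} {V : Set a} (E : V → V → Set e) → V → V → List V → Set (a ⊔ e)
IsPath E u v vs = Walk E u v vs × Unique vs

-- Strongly ⌊(d+1)/2⌋-linked, as in the paper's definition, for a graph (V, E)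
-- and the parameter d.
-- X = {x 0, ..., x d} (x injective, so exactly d+1 vertices);
-- the pairing {s_i, t_i} (i < k) is given by indices s, t : Fin k → Fin (d+1)
-- which together pick 2k distinct elements of X.
StronglyLinked : {a e : Level} {V : Set a} (E : V → V → Set e) (d : ℕ) → Set (a ⊔ e)
StronglyLinked {V = V} E d =
  (Σ (Fin (suc d) → V) (Injective _≡_ _≡_))
  ×
  ((x : Fin (suc d) → V) → Injective _≡_ _≡_ x →
   (s t : Fin k → Fin (suc d)) →
   Injective _≡_ _≡_ s → Injective _≡_ _≡_ t → (∀ i j → s i ≢ t j) →
   Σ (Fin k → List V) λ L →
     (∀ i → IsPath E (x (s i)) (x (t i)) (L i))
     × (∀ i j → i ≢ j → ∀ v → v ∈ L i → ¬ (v ∈ L j))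
     × (∀ i m → (∀ j → m ≢ s j) → (∀ j → m ≢ t j) → ¬ (x m ∈ L i)))
  where
  k : ℕ
  k = ⌊ suc d /2⌋

hamming : {d : ℕ} → Vec Bool d → Vec Bool d → ℕ
hamming [] [] = 0
hamming (true ∷ u) (true ∷ v) = hamming u v
hamming (false ∷ u) (false ∷ v) = hamming u v
hamming (true ∷ u) (false ∷ v) = suc (hamming u v)
hamming (false ∷ u) (true ∷ v) = suc (hamming u v)

CubeAdj : (d : ℕ) → Vec Bool d → Vec Bool d → Set
CubeAdj d u v = hamming u v ≡ 1

{-# OPTIONS --safe #-}

-- A linkage is encoded as a vertex colouring in which the ends of each pair are joined by a
-- monochromatic walk, so that disjointness is automatic.  Induction on the dimension: take d + 1
-- terminals.  By Bondy's theorem some coordinate i can be deleted so that all terminals but x₀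
-- keep distinct images; cut the cube along i.  If the terminals lie on both sides, choose u and w
-- on opposite sides, of different colours or joined by an edge in direction i, and link by
-- induction the images of all terminals but w on the side of u, and those of all terminals but u
-- on the side of w.  If all terminals lie on one side, link those other than x₀ there; the opposite
-- facet is free and takes over the pair of x₀ and the at most one pair whose path meets x₀.
-- The induction starts at d = 4, where all positions of the terminals are searched.

module Submission where

open import Defs
open import Data.Nat using (ℕ; zero; suc; _+_; _≤_; _<_; z≤n; s≤s; s<s; z<s; ⌊_/2⌋)
import Data.Nat.Properties as ℕ
open import Relation.Binary.PropositionalEquality
open import Data.Bool using (Bool; true; false; not; if_then_else_; _xor_; _∧_; _∨_; T)
open import Data.Bool.ListAction using (any)
import Data.Bool.Properties as Bool
open import Data.Fin as Fin using (Fin; zero; suc; toℕ; punchIn; punchOut; combine)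
open import Data.Fin.Properties as Fin using (any?; pigeonhole; punchInᵢ≢i; punchIn-injective;
  punchIn-punchOut; combine-injective)
open import Data.List as List using (List; []; _∷_; length)
open import Data.List.Membership.Propositional using (_∈_; _∉_; find)
open import Data.List.Membership.Propositional.Properties using (∈-map⁻)
open import Data.List.Relation.Unary.All as All using (All; []; _∷_)
open import Data.List.Relation.Unary.All.Properties using (¬Any⇒All¬)
open import Data.List.Relation.Unary.AllPairs using ([]; _∷_)
open import Data.List.Relation.Unary.Any as Any using (here; there)
open import Data.List.Relation.Unary.Any.Properties using (lookup-index; any⁻)
open import Data.List.Relation.Unary.Unique.Propositional using (Unique)
open import Data.Product using (Σ; ∃; _×_; _,_; proj₁; proj₂)
open import Data.Sum using (_⊎_; inj₁; inj₂; [_,_]′)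
open import Data.Unit using (tt)
open import Data.Vec as Vec using (Vec; []; _∷_; lookup; insertAt; removeAt)
open import Data.Vec.Properties using (insertAt-lookup; removeAt-insertAt; insertAt-removeAt;
  removeAt-punchOut; ≡-dec; ∷-injectiveʳ)
open import Function using (_∘_; _$_; Equivalence)
open import Function.Definitions using (Injective)
open import Relation.Binary.Construct.Closure.ReflexiveTransitive using (Star; ε; _◅_; _◅◅_; gmap; reverse)
open import Relation.Nullary using (¬_; Dec; yes; no; does; contradiction; ¬?; _×-dec_)
open import Relation.Nullary.Decidable using (dec-true; dec-false; decidable-stable)

private
  variable
    n m : ℕ

infix 4 _≟ⱽ_
_≟ⱽ_ : (u v : Vec Bool n) → Dec (u ≡ v)
_≟ⱽ_ = ≡-dec Bool._≟_

-- Bondy's theorem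

differingCoordinate : (u v : Vec Bool n) → u ≢ v → ∃ λ k → lookup u k ≢ lookup v k
differingCoordinate [] [] u≢v = contradiction refl u≢v
differingCoordinate (a ∷ u) (b ∷ v) u≢v with a Bool.≟ b
... | no a≢b = zero , a≢b
... | yes refl with k , ne ← differingCoordinate u v (u≢v ∘ cong (a ∷_)) = suc k , ne

AgreeOn : List (Fin n) → Vec Bool n → Vec Bool n → Set
AgreeOn D u v = All (λ k → lookup u k ≡ lookup v k) D

-- Induction on the number of vertices. If `D` separates all vertices but the first, at most one of
-- them agrees with the first on `D`, and a single further coordinate tells these two apart.
separatingCoordinates : (x : Fin (suc m) → Vec Bool n) → Injective _≡_ _≡_ x →
  ∃ λ D → length D ≤ m × (∀ p q → AgreeOn D (x p) (x q) → p ≡ q)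
separatingCoordinates {m = zero} x x-inj = [] , z≤n , λ { zero zero _ → refl }
separatingCoordinates {m = suc m} x x-inj
  with separatingCoordinates (x ∘ suc) (Fin.suc-injective ∘ x-inj)
... | D , D≤m , sep with any? (λ q → All.all? (λ k → lookup (x zero) k Bool.≟ lookup (x (suc q)) k) D)
... | no none = D , ℕ.m≤n⇒m≤1+n D≤m , sep′
  where
  sep′ : ∀ p q → AgreeOn D (x p) (x q) → p ≡ q
  sep′ zero zero _ = refl
  sep′ zero (suc q) a = contradiction (q , a) none
  sep′ (suc p) zero a = contradiction (p , All.map sym a) none
  sep′ (suc p) (suc q) a = cong suc (sep p q a)
... | yes (r , zero~r) with k , ne ← differingCoordinate (x zero) (x (suc r)) ((λ ()) ∘ x-inj)
  = k ∷ D , s≤s D≤m , sep′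
  where
  distinguished : ∀ q → ¬ AgreeOn (k ∷ D) (x zero) (x (suc q))
  distinguished q (e ∷ a) with refl ← sep r q (All.zipWith (λ (e , f) → trans (sym e) f) (zero~r , a)) = ne e
  sep′ : ∀ p q → AgreeOn (k ∷ D) (x p) (x q) → p ≡ q
  sep′ zero zero _ = refl
  sep′ zero (suc q) a = contradiction a (distinguished q)
  sep′ (suc p) zero a = contradiction (All.map sym a) (distinguished p)
  sep′ (suc p) (suc q) (_ ∷ a) = cong suc (sep p q a)

missingIndex : (D : List (Fin n)) → length D < n → ∃ λ i → i ∉ D
missingIndex D D<n with any? (λ i → ¬? (Any.any? (i Fin.≟_) D))
... | yes e = e
-- If every index occurred in `D`, two different indices would be found at the same position of `D`.
... | no none = let i , j , i<j , e = pigeonhole D<n (Any.index ∘ all∈) in contradiction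
    (trans (lookup-index (all∈ i)) (trans (cong (List.lookup D) e) (sym (lookup-index (all∈ j)))))
    (Fin.<⇒≢ i<j)
  where
  all∈ : ∀ i → i ∈ D
  all∈ i = decidable-stable (Any.any? (i Fin.≟_) D) (λ i∉D → none (i , i∉D))

-- Separating the vertices takes fewer coordinates than the cube has, so some coordinate lies
-- outside `D`; deleting it leaves the entries at `D` readable.
bondy : (x : Fin (suc n) → Vec Bool (suc n)) → Injective _≡_ _≡_ x →
  ∃ λ i → ∀ {p q} → removeAt (x p) i ≡ removeAt (x q) i → p ≡ q
bondy x x-inj with D , D≤n , sep ← separatingCoordinates x x-inj
              with i , i∉D ← missingIndex D (s≤s D≤n)
  = i , λ {p} {q} e → sep p q (All.tabulate λ k∈D →
      let i≢k = λ i≡k → i∉D (subst (_∈ D) (sym i≡k) k∈D) in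
      trans (sym (removeAt-punchOut (x p) i≢k))
        (trans (cong (λ v → lookup v (punchOut i≢k)) e) (removeAt-punchOut (x q) i≢k)))

-- Linkages as colourings

hamming-refl : (u : Vec Bool n) → hamming u u ≡ 0
hamming-refl [] = refl
hamming-refl (true ∷ u) = hamming-refl u
hamming-refl (false ∷ u) = hamming-refl u

hamming-sym : (u v : Vec Bool n) → hamming u v ≡ hamming v u
hamming-sym [] [] = refl
hamming-sym (true ∷ u) (true ∷ v) = hamming-sym u v
hamming-sym (true ∷ u) (false ∷ v) = cong suc (hamming-sym u v)
hamming-sym (false ∷ u) (true ∷ v) = cong suc (hamming-sym u v)
hamming-sym (false ∷ u) (false ∷ v) = hamming-sym u v

hamming-insertAt : (u v : Vec Bool n) (i : Fin (suc n)) (b : Bool) →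
  hamming (insertAt u i b) (insertAt v i b) ≡ hamming u v
hamming-insertAt u v zero true = refl
hamming-insertAt u v zero false = refl
hamming-insertAt (true ∷ u) (true ∷ v) (suc i) b = hamming-insertAt u v i b
hamming-insertAt (true ∷ u) (false ∷ v) (suc i) b = cong suc (hamming-insertAt u v i b)
hamming-insertAt (false ∷ u) (true ∷ v) (suc i) b = cong suc (hamming-insertAt u v i b)
hamming-insertAt (false ∷ u) (false ∷ v) (suc i) b = hamming-insertAt u v i b

hamming-insertAt-≢ : (u : Vec Bool n) (i : Fin (suc n)) {a b : Bool} → a ≢ b →
  hamming (insertAt u i a) (insertAt u i b) ≡ 1
hamming-insertAt-≢ u zero {true} {true} a≢b = contradiction refl a≢b
hamming-insertAt-≢ u zero {true} {false} a≢b = cong suc (hamming-refl u)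
hamming-insertAt-≢ u zero {false} {true} a≢b = cong suc (hamming-refl u)
hamming-insertAt-≢ u zero {false} {false} a≢b = contradiction refl a≢b
hamming-insertAt-≢ (true ∷ u) (suc i) a≢b = hamming-insertAt-≢ u i a≢b
hamming-insertAt-≢ (false ∷ u) (suc i) a≢b = hamming-insertAt-≢ u i a≢b

-- The colour is asked of both ends of every edge, which makes reversal immediate. The empty walk
-- asks nothing, so the colour of its vertex has to be known separately.
Mono : (Vec Bool n → ℕ) → ℕ → Vec Bool n → Vec Bool n → Set
Mono c γ = Star (λ u v → CubeAdj _ u v × c u ≡ γ × c v ≡ γ)

Mono-sym : {c : Vec Bool n → ℕ} {γ : ℕ} {u v : Vec Bool n} → Mono c γ u v → Mono c γ v u
Mono-sym = reverse λ {u} {v} (e , a , b) → trans (hamming-sym v u) e , b , a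

-- Every vertex of the cube gets a colour, and those off the walks may get any. Since terminals keep
-- their own colours, no walk can run through a terminal of another colour.
Linkable : {I : Set} (x : I → Vec Bool n) (col : I → ℕ) → Set
Linkable {n} x col = Σ (Vec Bool n → ℕ) λ c →
  (∀ p → c (x p) ≡ col p) × (∀ p q → col p ≡ col q → Mono c (col p) (x p) (x q))

-- The Boolean of a label tells the two ends of a pair apart, so that an injective labelling
-- uses each colour at most twice.
AlwaysLinkable : ℕ → Set
AlwaysLinkable n = (x : Fin (suc n) → Vec Bool n) (lab : Fin (suc n) → ℕ × Bool) →
  Injective _≡_ _≡_ x → Injective _≡_ _≡_ lab → Linkable x (proj₁ ∘ lab)

bit : Bool → Fin 2
bit false = zero
bit true = suc zero

bit-injective : ∀ {a b} → bit a ≡ bit b → a ≡ b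
bit-injective {false} {false} _ = refl
bit-injective {true} {true} _ = refl

module _ {I : Set} {lab : I → ℕ × Bool} (lab-inj : Injective _≡_ _≡_ lab) where

  -- Two of the three Booleans coincide, and with equal colours this would make two labels equal.
  noThreeOfAColour : {p q r : I} → p ≢ q → p ≢ r → q ≢ r →
    proj₁ (lab p) ≡ proj₁ (lab q) → proj₁ (lab p) ≢ proj₁ (lab r)
  noThreeOfAColour {p} {q} {r} p≢q p≢r q≢r e f
    with proj₂ (lab p) in a | proj₂ (lab q) in b | proj₂ (lab r) in c
  ... | true  | true  | _     = p≢q (lab-inj (cong₂ _,_ e (trans a (sym b))))
  ... | false | false | _     = p≢q (lab-inj (cong₂ _,_ e (trans a (sym b))))
  ... | true  | false | true  = p≢r (lab-inj (cong₂ _,_ f (trans a (sym c))))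
  ... | false | true  | false = p≢r (lab-inj (cong₂ _,_ f (trans a (sym c))))
  ... | true  | false | false = q≢r (lab-inj (cong₂ _,_ (trans (sym e) f) (trans b (sym c))))
  ... | false | true  | true  = q≢r (lab-inj (cong₂ _,_ (trans (sym e) f) (trans b (sym c))))

-- Only four labels have one of the colours `γ` and `δ`, and more than four distinct labels are
-- given.
avoidTwoColours : 4 < m → {lab : Fin m → ℕ × Bool} → Injective _≡_ _≡_ lab → (γ δ : ℕ) →
  ∃ λ y → proj₁ (lab y) ≢ γ × proj₁ (lab y) ≢ δ
avoidTwoColours {m} 4<m {lab} lab-inj γ δ
  with any? (λ y → ¬? (proj₁ (lab y) ℕ.≟ γ) ×-dec ¬? (proj₁ (lab y) ℕ.≟ δ))
... | yes e = e
... | no none = contradiction (lab-inj (cong₂ _,_ colours≡ (bit-injective (proj₂ bits≡)))) (Fin.<⇒≢ i<j)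
  where
  isγ : Fin m → Bool
  isγ y = does (proj₁ (lab y) ℕ.≟ γ)
  ph = pigeonhole 4<m (λ y → combine (bit (isγ y)) (bit (proj₂ (lab y))))
  i = proj₁ ph
  j = proj₁ (proj₂ ph)
  i<j = proj₁ (proj₂ (proj₂ ph))
  bits≡ = combine-injective (bit (isγ i)) _ (bit (isγ j)) _ (proj₂ (proj₂ (proj₂ ph)))
  colour : ∀ y → proj₁ (lab y) ≡ (if isγ y then γ else δ)
  colour y with proj₁ (lab y) ℕ.≟ γ
  ... | yes e = trans e (sym (cong (if_then γ else δ) (dec-true (proj₁ (lab y) ℕ.≟ γ) e)))
  ... | no ≢γ = trans (decidable-stable (_ ℕ.≟ δ) (λ ≢δ → none (y , ≢γ , ≢δ)))
          (sym (cong (if_then γ else δ) (dec-false (proj₁ (lab y) ℕ.≟ γ) ≢γ)))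
  colours≡ : proj₁ (lab i) ≡ proj₁ (lab j)
  colours≡ = trans (colour i)
    (trans (cong (if_then γ else δ) (bit-injective (proj₁ bits≡))) (sym (colour j)))

-- All terminals keep their indices while `w` is disregarded, so that linkages omitting different
-- terminals can be combined. A partner of `w` must still receive its colour.
LinkableWithout : Fin (suc m) → (x : Fin (suc m) → Vec Bool n) (col : Fin (suc m) → ℕ) → Set
LinkableWithout {n = n} w x col = Σ (Vec Bool n → ℕ) λ c →
  (∀ p → w ≢ p → c (x p) ≡ col p) ×
  (∀ p q → w ≢ p → w ≢ q → col p ≡ col q → Mono c (col p) (x p) (x q))

linkableWithout : AlwaysLinkable n → (w : Fin (2 + n)) (x : Fin (2 + n) → Vec Bool n)
  (lab : Fin (2 + n) → ℕ × Bool) → (∀ p q → w ≢ p → w ≢ q → x p ≡ x q → p ≡ q) →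
  Injective _≡_ _≡_ lab → LinkableWithout w x (proj₁ ∘ lab)
linkableWithout IH w x lab x-inj lab-inj
  with c , ext , conn ← IH (x ∘ punchIn w) (lab ∘ punchIn w)
         (λ e → punchIn-injective w _ _ (x-inj _ _ (punchInᵢ≢i w _ ∘ sym) (punchInᵢ≢i w _ ∘ sym) e))
         (λ e → punchIn-injective w _ _ (lab-inj e))
  = c , ext′ , conn′
  where
  ext′ : ∀ p → w ≢ p → c (x p) ≡ proj₁ (lab p)
  ext′ p w≢p = subst (λ r → c (x r) ≡ proj₁ (lab r)) (punchIn-punchOut w≢p) (ext (punchOut w≢p))
  conn′ : ∀ p q → w ≢ p → w ≢ q → proj₁ (lab p) ≡ proj₁ (lab q) → Mono c (proj₁ (lab p)) (x p) (x q)
  conn′ p q w≢p w≢q e = subst₂ P (punchIn-punchOut w≢p) (punchIn-punchOut w≢q)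
      (conn (punchOut w≢p) (punchOut w≢q)) e
    where
    P : Fin _ → Fin _ → Set
    P r s = proj₁ (lab r) ≡ proj₁ (lab s) → Mono c (proj₁ (lab r)) (x r) (x s)

-- The induction step

module Glue (i : Fin (suc n)) (C : Bool → Vec Bool n → ℕ) where

  private
    ρ : Vec Bool (suc n) → Vec Bool n
    ρ v = removeAt v i

  glued : Vec Bool (suc n) → ℕ
  glued v = C (lookup v i) (ρ v)

  glued-insertAt : ∀ v b → glued (insertAt v i b) ≡ C b v
  glued-insertAt v b = cong₂ C (insertAt-lookup v i b) (removeAt-insertAt v i b)

  glued-Mono : ∀ {b γ u v} → Mono (C b) γ u v → Mono glued γ (insertAt u i b) (insertAt v i b)
  glued-Mono {b} = gmap (λ v → insertAt v i b) λ {u} {v} (a , cu , cv) →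
    trans (hamming-insertAt u v i b) a , trans (glued-insertAt u b) cu , trans (glued-insertAt v b) cv

  -- Either `v` lies on the side `b` already, or the edge in direction `i` leads to its copy there.
  toSide : ∀ b {γ} v → glued v ≡ γ → C b (ρ v) ≡ γ → Mono glued γ v (insertAt (ρ v) i b)
  toSide b {γ} v cv cv′ with lookup v i Bool.≟ b
  ... | yes refl = subst (Mono glued γ v) (sym (insertAt-removeAt v i)) ε
  ... | no ≢b = (adj , cv , trans (glued-insertAt (ρ v) b) cv′) ◅ ε
    where
    adj : hamming v (insertAt (ρ v) i b) ≡ 1
    adj = subst (λ u → hamming u (insertAt (ρ v) i b) ≡ 1) (insertAt-removeAt v i)
      (hamming-insertAt-≢ (ρ v) i ≢b)

  -- A linkage in one facet thus serves terminals of both facets, provided that it gives their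
  -- copies the right colour.
  viaSide : ∀ b {γ} {u v} → glued u ≡ γ → glued v ≡ γ → C b (ρ u) ≡ γ → C b (ρ v) ≡ γ →
    Mono (C b) γ (ρ u) (ρ v) → Mono glued γ u v
  viaSide b {u = u} {v} cu cv cu′ cv′ w =
    toSide b u cu cu′ ◅◅ glued-Mono w ◅◅ Mono-sym (toSide b v cv cv′)

sides : {A : Set} → Bool → A → A → Bool → A
sides b f g s = if does (s Bool.≟ b) then f else g

sides-≡ : {A : Set} {b s : Bool} (f g : A) → s ≡ b → sides b f g s ≡ f
sides-≡ {b = b} {s} f g e = cong (if_then f else g) (dec-true (s Bool.≟ b) e)

sides-≢ : {A : Set} {b s : Bool} (f g : A) → s ≢ b → sides b f g s ≡ g
sides-≢ {b = b} {s} f g ne = cong (if_then f else g) (dec-false (s Bool.≟ b) ne)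

module Step (IH : AlwaysLinkable n) (x : Fin (2 + n) → Vec Bool (suc n)) (lab : Fin (2 + n) → ℕ × Bool)
  (x-inj : Injective _≡_ _≡_ x) (lab-inj : Injective _≡_ _≡_ lab) (i : Fin (suc n)) where

  ρ : Fin (2 + n) → Vec Bool n
  ρ p = removeAt (x p) i

  side : Fin (2 + n) → Bool
  side p = lookup (x p) i

  col : Fin (2 + n) → ℕ
  col = proj₁ ∘ lab

  ρ-side-injective : ∀ {p q} → side p ≡ side q → ρ p ≡ ρ q → p ≡ q
  ρ-side-injective {p} {q} e f = x-inj (trans (sym (insertAt-removeAt (x p) i))
    (trans (cong₂ (λ v → insertAt v i) f e) (insertAt-removeAt (x q) i)))

  ρ-injective-flat : (∀ p → side p ≡ side zero) → ∀ {p q} → ρ p ≡ ρ q → p ≡ q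
  ρ-injective-flat flat {p} {q} = ρ-side-injective (trans (flat p) (sym (flat q)))

  -- The side of u handles all terminals but w, the side of w all terminals but u:
  -- every other terminal is joined to its copy on the opposite side.
  linkableSplit : ∀ u w → side u ≢ side w →
    (∀ p q → w ≢ p → w ≢ q → ρ p ≡ ρ q → p ≡ q) → (∀ p q → u ≢ p → u ≢ q → ρ p ≡ ρ q → p ≡ q) →
    col u ≢ col w ⊎ ρ u ≡ ρ w → Linkable x col
  linkableSplit u w u≁w inj-w inj-u harmless
    with cᵤ , extᵤ , connᵤ ← linkableWithout IH w ρ lab inj-w lab-inj
       | cᵥ , extᵥ , connᵥ ← linkableWithout IH u ρ lab inj-u lab-inj
    = glued , ext , conn
    where
    C : Bool → Vec Bool _ → ℕ
    C = sides (side u) cᵤ cᵥ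
    open Glue i C
    Cᵤ : C (side u) ≡ cᵤ
    Cᵤ = sides-≡ {b = side u} cᵤ cᵥ refl
    Cᵥ : C (side w) ≡ cᵥ
    Cᵥ = sides-≢ cᵤ cᵥ (u≁w ∘ sym)
    extᵤ′ : ∀ p → w ≢ p → C (side u) (ρ p) ≡ col p
    extᵤ′ p w≢p = trans (cong (_$ ρ p) Cᵤ) (extᵤ p w≢p)
    extᵥ′ : ∀ p → u ≢ p → C (side w) (ρ p) ≡ col p
    extᵥ′ p u≢p = trans (cong (_$ ρ p) Cᵥ) (extᵥ p u≢p)
    ext : ∀ p → glued (x p) ≡ col p
    ext p with side p Bool.≟ side u
    ... | yes e = extᵤ p λ { refl → u≁w (sym e) }
    ... | no ne = extᵥ p λ { refl → ne refl }
    -- Each facet omits one of `u` and `w`, so neither can link these two. If they share a colour,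
    -- `harmless` makes them the ends of an edge in direction `i`.
    cross : col u ≡ col w → Mono glued (col u) (x u) (x w)
    cross e = subst (Mono glued (col u) (x u)) xw≡
        (toSide (side w) (x u) (ext u)
          (trans (cong (C (side w)) f) (trans (extᵥ′ w λ { refl → u≁w refl }) (sym e))))
      where
      f : ρ u ≡ ρ w
      f = [ contradiction e , (λ f → f) ]′ harmless
      xw≡ : insertAt (ρ u) i (side w) ≡ x w
      xw≡ = trans (cong (λ v → insertAt v i (side w)) f) (insertAt-removeAt (x w) i)
    viaU : ∀ p q → w ≢ p → w ≢ q → col p ≡ col q → Mono glued (col p) (x p) (x q)
    viaU p q w≢p w≢q e = viaSide (side u) (ext p) (trans (ext q) (sym e)) (extᵤ′ p w≢p)
      (trans (extᵤ′ q w≢q) (sym e)) (subst (λ c → Mono c (col p) (ρ p) (ρ q)) (sym Cᵤ) (connᵤ p q w≢p w≢q e))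
    viaW : ∀ p q → u ≢ p → u ≢ q → col p ≡ col q → Mono glued (col p) (x p) (x q)
    viaW p q u≢p u≢q e = viaSide (side w) (ext p) (trans (ext q) (sym e)) (extᵥ′ p u≢p)
      (trans (extᵥ′ q u≢q) (sym e)) (subst (λ c → Mono c (col p) (ρ p) (ρ q)) (sym Cᵥ) (connᵥ p q u≢p u≢q e))
    fromW : ∀ q → col w ≡ col q → Mono glued (col w) (x w) (x q)
    fromW q e with u Fin.≟ q
    ... | yes refl = Mono-sym (subst (λ γ → Mono glued γ (x u) (x w)) (sym e) (cross (sym e)))
    ... | no u≢q = viaW w q (λ { refl → u≁w refl }) u≢q e
    conn : ∀ p q → col p ≡ col q → Mono glued (col p) (x p) (x q)
    conn p q e with w Fin.≟ p | w Fin.≟ q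
    ... | no w≢p | no w≢q = viaU p q w≢p w≢q e
    ... | yes refl | _ = fromW q e
    ... | no _ | yes refl = Mono-sym (subst (λ γ → Mono glued γ (x w) (x p)) (sym e) (fromW p (sym e)))

  -- Link all terminals but x 0 inside the facet.  At most the pair coloured j has a path through x 0;
  -- this pair and the pair of x 0 are linked in the opposite facet instead.
  linkableFlat : 3 ≤ n → (∀ p → side p ≡ side zero) → Linkable x col
  linkableFlat 3≤n flat
    with c₀ , ext₀ , conn₀ ← linkableWithout IH zero ρ lab (λ p q _ _ → ρ-injective-flat flat) lab-inj
    -- The opposite facet also takes only `suc n` terminals, so `y` is dropped there. Its colour
    -- differs from both rerouted colours, hence no rerouted pair loses an end. The bound `3 ≤ n`
    -- supplies the five terminals needed to find `y`.
    with y , y≢zero , y≢j ← avoidTwoColours (s≤s (s≤s 3≤n)) lab-inj (col zero) (c₀ (ρ zero))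
    with c₁ , ext₁ , conn₁ ← linkableWithout IH y ρ lab (λ p q _ _ → ρ-injective-flat flat) lab-inj
    = glued , ext , conn
    where
    ρ-inj : ∀ {p q} → ρ p ≡ ρ q → p ≡ q
    ρ-inj = ρ-injective-flat flat
    b = side zero
    j = c₀ (ρ zero)
    -- The linkage `c₀` ignored the terminal `zero` and may have coloured its position `j`.
    -- Restoring the right colour there can break only walks coloured `j`.
    c₀′ : Vec Bool _ → ℕ
    c₀′ v = if does (v ≟ⱽ ρ zero) then col zero else c₀ v
    C : Bool → Vec Bool _ → ℕ
    C = sides b c₀′ c₁
    open Glue i C
    C₀ : C b ≡ c₀′
    C₀ = sides-≡ {b = b} c₀′ c₁ refl
    C₁ : C (not b) ≡ c₁
    C₁ = sides-≢ {b = b} c₀′ c₁ (Bool.not-¬ refl ∘ sym)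
    c₀′-≢ : ∀ {v} → c₀ v ≢ j → c₀′ v ≡ c₀ v
    c₀′-≢ {v} ne with v ≟ⱽ ρ zero
    ... | yes refl = contradiction refl ne
    ... | no _ = refl
    ext₀′ : ∀ p → c₀′ (ρ p) ≡ col p
    ext₀′ p with ρ p ≟ⱽ ρ zero
    ... | yes e = cong col (sym (ρ-inj e))
    ... | no ne = ext₀ p λ { refl → ne refl }
    ext₀″ : ∀ p → C b (ρ p) ≡ col p
    ext₀″ p = trans (cong (_$ ρ p) C₀) (ext₀′ p)
    ext : ∀ p → glued (x p) ≡ col p
    ext p = trans (cong (λ s → C s (ρ p)) (flat p)) (ext₀″ p)
    viaOpposite : ∀ p q → col y ≢ col p → col p ≡ col q → Mono glued (col p) (x p) (x q)
    viaOpposite p q y≁p e = viaSide (not b) (ext p) (trans (ext q) (sym e))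
        (trans (cong (_$ ρ p) C₁) (ext₁ p y≢p))
        (trans (cong (_$ ρ q) C₁) (trans (ext₁ q y≢q) (sym e)))
        (subst (λ c → Mono c (col p) (ρ p) (ρ q)) (sym C₁) (conn₁ p q y≢p y≢q e))
      where
      y≢p : y ≢ p
      y≢p refl = y≁p refl
      y≢q : y ≢ q
      y≢q refl = y≁p (sym e)
    conn : ∀ p q → col p ≡ col q → Mono glued (col p) (x p) (x q)
    conn p q e with col p ℕ.≟ col zero | col p ℕ.≟ j
    ... | yes f | _ = viaOpposite p q (λ g → y≢zero (trans g f)) e
    ... | no _ | yes f = viaOpposite p q (λ g → y≢j (trans g f)) e
    ... | no p≁zero | no p≁j = viaSide b (ext p) (trans (ext q) (sym e)) (ext₀″ p)
        (trans (ext₀″ q) (sym e)) (subst (λ c → Mono c (col p) (ρ p) (ρ q)) (sym C₀)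
          (gmap (λ v → v) (λ (a , cu , cv) → a , keep cu , keep cv)
            (conn₀ p q (λ { refl → p≁zero refl }) (λ { refl → p≁zero e }) e)))
      where
      keep : ∀ {v} → c₀ v ≡ col p → c₀′ v ≡ col p
      keep cv = trans (c₀′-≢ (p≁j ∘ trans (sym cv))) cv

  -- If `zero` has the same image as another terminal, these two are the ends of an edge in
  -- direction `i`, and omitting either makes the images distinct. Otherwise all images are
  -- distinct, and two terminals of different colours on opposite sides suffice. The flat case is an
  -- argument because it is impossible in dimension 2 and needs rerouting in higher dimensions.
  linkableUnlessFlat : 1 ≤ n → (∀ {p q} → ρ (suc p) ≡ ρ (suc q) → p ≡ q) →
    ((∀ p → side p ≡ side zero) → Linkable x col) → Linkable x col
  linkableUnlessFlat 1≤n inj flatCase with any? (λ q → ρ zero ≟ⱽ ρ (suc q))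
  ... | yes (q , e) = linkableSplit zero (suc q)
          (λ s → contradiction (ρ-side-injective s e) λ ()) inj-w inj-u (inj₂ e)
    where
    inj-u : ∀ p r → zero ≢ p → zero ≢ r → ρ p ≡ ρ r → p ≡ r
    inj-u zero _ ne _ _ = contradiction refl ne
    inj-u (suc _) zero _ ne _ = contradiction refl ne
    inj-u (suc p) (suc r) _ _ f = cong suc (inj f)
    inj-w : ∀ p r → suc q ≢ p → suc q ≢ r → ρ p ≡ ρ r → p ≡ r
    inj-w zero zero _ _ _ = refl
    inj-w zero (suc r) _ ne f = contradiction (cong suc (inj (trans (sym e) f))) ne
    inj-w (suc p) zero ne _ f = contradiction (cong suc (inj (sym (trans f e)))) ne
    inj-w (suc p) (suc r) _ _ f = cong suc (inj f)
  ... | no none with any? (λ q → ¬? (side q Bool.≟ side zero))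
  ... | no flat = flatCase (λ p → decidable-stable (side p Bool.≟ side zero) (λ ne → flat (p , ne)))
  ... | yes (q , q≁zero) = finish (third 1≤n zero q)
    where
    ρ-inj : ∀ p r → ρ p ≡ ρ r → p ≡ r
    ρ-inj zero zero _ = refl
    ρ-inj zero (suc r) f = contradiction (r , f) none
    ρ-inj (suc p) zero f = contradiction (p , sym f) none
    ρ-inj (suc p) (suc r) f = cong suc (inj f)
    split : ∀ u w → side u ≢ side w → col u ≢ col w → Linkable x col
    split u w s ne = linkableSplit u w s (λ p r _ _ → ρ-inj p r) (λ p r _ _ → ρ-inj p r) (inj₁ ne)
    third : ∀ {n} → 1 ≤ n → (p r : Fin (2 + n)) → ∃ λ z → p ≢ z × r ≢ z
    third (s≤s _) zero zero = suc zero , (λ ()) , λ ()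
    third (s≤s _) zero (suc zero) = suc (suc zero) , (λ ()) , λ ()
    third (s≤s _) zero (suc (suc _)) = suc zero , (λ ()) , λ ()
    third (s≤s _) (suc zero) zero = suc (suc zero) , (λ ()) , λ ()
    third (s≤s _) (suc (suc _)) zero = suc zero , (λ ()) , λ ()
    third (s≤s _) (suc _) (suc _) = zero , (λ ()) , λ ()
    -- If `zero` and `q` share a colour, a third terminal `z` has another one, and it lies opposite
    -- to one of the two.
    finish : (∃ λ z → zero ≢ z × q ≢ z) → Linkable x col
    finish (z , zero≢z , q≢z) with col zero ℕ.≟ col q
    ... | no ne = split zero q (q≁zero ∘ sym) ne
    ... | yes e with side z Bool.≟ side zero
    ... | no z≁zero = split zero z (z≁zero ∘ sym)
          (noThreeOfAColour lab-inj (λ { refl → q≁zero refl }) zero≢z q≢z e)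
    ... | yes f = split z q (λ g → q≁zero (trans (sym g) f))
          (λ g → noThreeOfAColour lab-inj (λ { refl → q≁zero refl }) zero≢z q≢z e (trans e (sym g)))

-- Bondy's theorem takes as many vertices as there are coordinates, so the terminal `zero` is set
-- aside.
alwaysLinkable-step : 3 ≤ n → AlwaysLinkable n → AlwaysLinkable (suc n)
alwaysLinkable-step 3≤n IH x lab x-inj lab-inj
  with i , inj ← bondy (x ∘ suc) (Fin.suc-injective ∘ x-inj)
  = linkableUnlessFlat (ℕ.≤-trans (s≤s z≤n) 3≤n) inj (linkableFlat 3≤n)
  where open Step IH x lab x-inj lab-inj i

-- Dimensions 1 and 2

alwaysLinkable₁ : AlwaysLinkable 1
alwaysLinkable₁ x lab x-inj lab-inj = c , ext , conn
  where
  c : Vec Bool 1 → ℕ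
  -- The two terminals are the only vertices of the 1-cube, so the second branch always concerns the
  -- other terminal.
  c v = if does (v ≟ⱽ x zero) then proj₁ (lab zero) else proj₁ (lab (suc zero))
  ext : ∀ p → c (x p) ≡ proj₁ (lab p)
  ext p with x p ≟ⱽ x zero
  ... | yes e = cong (proj₁ ∘ lab) (sym (x-inj e))
  ext zero | no ne = contradiction refl ne
  ext (suc zero) | no ne = refl
  adjacent : ∀ u v → u ≢ v → CubeAdj 1 u v
  adjacent (true ∷ []) (true ∷ []) ne = contradiction refl ne
  adjacent (true ∷ []) (false ∷ []) ne = refl
  adjacent (false ∷ []) (true ∷ []) ne = refl
  adjacent (false ∷ []) (false ∷ []) ne = contradiction refl ne
  conn : ∀ p q → proj₁ (lab p) ≡ proj₁ (lab q) → Mono c (proj₁ (lab p)) (x p) (x q)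
  conn p q e with p Fin.≟ q
  ... | yes refl = ε
  ... | no p≢q = (adjacent _ _ (p≢q ∘ x-inj) , ext p , trans (ext q) (sym e)) ◅ ε

-- The flat case cannot occur: a side of the square has two vertices, too few for three terminals.
alwaysLinkable₂ : AlwaysLinkable 2
alwaysLinkable₂ x lab x-inj lab-inj
  with i , inj ← bondy (x ∘ suc) (Fin.suc-injective ∘ x-inj)
  = linkableUnlessFlat (s≤s z≤n) inj notFlat
  where
  open Step alwaysLinkable₁ x lab x-inj lab-inj i
  head-injective : {u v : Vec Bool 1} → Vec.head u ≡ Vec.head v → u ≡ v
  head-injective {_ ∷ []} {_ ∷ []} = cong (_∷ [])
  notFlat : (∀ p → side p ≡ side zero) → Linkable x col
  notFlat flat with p , q , p<q , e ← pigeonhole (s<s (s<s z<s)) (bit ∘ Vec.head ∘ ρ)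
    = contradiction (ρ-injective-flat flat (head-injective (bit-injective e))) (Fin.<⇒≢ p<q)

-- The 4-cube

_∈?_ : (v : Vec Bool n) (vs : List (Vec Bool n)) → Dec (v ∈ vs)
v ∈? vs = Any.any? (v ≟ⱽ_) vs

neighbours : Vec Bool n → List (Vec Bool n)
neighbours [] = []
neighbours (b ∷ v) = (not b ∷ v) ∷ List.map (b ∷_) (neighbours v)

neighbours-adjacent : (u : Vec Bool n) {v : Vec Bool n} → v ∈ neighbours u → CubeAdj n u v
neighbours-adjacent (true ∷ u) (here refl) = cong suc (hamming-refl u)
neighbours-adjacent (false ∷ u) (here refl) = cong suc (hamming-refl u)
neighbours-adjacent (true ∷ u) (there v∈) with _ , w∈ , refl ← ∈-map⁻ (true ∷_) v∈ = neighbours-adjacent u w∈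
neighbours-adjacent (false ∷ u) (there v∈) with _ , w∈ , refl ← ∈-map⁻ (false ∷_) v∈ = neighbours-adjacent u w∈

-- Backtracking search for a walk from s to t with at most f inner vertices, none of them in B;
-- the continuation k receives B enlarged by these inner vertices.
search : ℕ → (s t : Vec Bool n) (B : List (Vec Bool n)) (k : List (Vec Bool n) → Bool) → Bool
search zero s t B k = does (t ∈? neighbours s) ∧ k B
search (suc f) s t B k = if does (t ∈? neighbours s) then k B else
  any (λ v → not (does (v ∈? B)) ∧ search f v t (v ∷ B) k) (neighbours s)

WalkIn : List (Vec Bool n) → Vec Bool n → Vec Bool n → Set
WalkIn W = Star (λ u v → CubeAdj _ u v × u ∈ W × v ∈ W)

T-not-does : {A : Set} (d : Dec A) → T (not (does d)) → ¬ A
T-not-does (no ¬a) _ = ¬a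

-- Of `rest` it only matters that it contains `B` and the inner vertices: a second walk that avoids
-- `rest` avoids the terminals and the first walk at once.
record Found (s t : Vec Bool n) (B : List (Vec Bool n)) (k : List (Vec Bool n) → Bool) : Set where
  field
    inner : List (Vec Bool n)
    walk : WalkIn (s ∷ t ∷ inner) s t
    avoids : ∀ {v} → v ∈ inner → v ∉ B
    rest : List (Vec Bool n)
    B⊆rest : ∀ {v} → v ∈ B → v ∈ rest
    inner⊆rest : ∀ {v} → v ∈ inner → v ∈ rest
    continue : T (k rest)

found-edge : {s t : Vec Bool n} {B : List (Vec Bool n)} {k : List (Vec Bool n) → Bool} →
  CubeAdj n s t → T (k B) → Found s t B k
found-edge {B = B} adj kB = record
  { inner = [] ; walk = (adj , here refl , there (here refl)) ◅ ε ; avoids = λ ()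
  ; rest = B ; B⊆rest = λ v∈ → v∈ ; inner⊆rest = λ () ; continue = kB }

search-sound : ∀ f (s t : Vec Bool n) B k → T (search f s t B k) → Found s t B k
search-sound zero s t B k ok with t ∈? neighbours s
... | yes t∈ = found-edge (neighbours-adjacent s t∈) ok
search-sound (suc f) s t B k ok with t ∈? neighbours s
... | yes t∈ = found-edge (neighbours-adjacent s t∈) ok
... | no _ with v , v∈ , ok′ ← find (any⁻ _ (neighbours s) ok)
  with v∉ , ok″ ← Equivalence.to (Bool.T-∧ {not (does (v ∈? B))}) ok′ = record
  { inner = v ∷ F.inner
  ; walk = (neighbours-adjacent s v∈ , here refl , there (there (here refl))) ◅
      gmap (λ w → w) (λ (a , p , q) → a , widen p , widen q) F.walk
  ; avoids = λ { (here refl) → T-not-does (v ∈? B) v∉ ; (there w∈) → F.avoids w∈ ∘ there }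
  ; rest = F.rest
  ; B⊆rest = F.B⊆rest ∘ there
  ; inner⊆rest = λ { (here refl) → F.B⊆rest (here refl) ; (there w∈) → F.inner⊆rest w∈ }
  ; continue = F.continue }
  where
  module F = Found (search-sound f v t (v ∷ B) k ok″)
  widen : ∀ {w} → w ∈ v ∷ t ∷ F.inner → w ∈ s ∷ t ∷ v ∷ F.inner
  widen (here e) = there (there (here e))
  widen (there (here e)) = there (here e)
  widen (there (there w∈)) = there (there (there w∈))

-- The exhaustive check

everywhere : ∀ n → (Vec Bool n → Bool) → Bool
everywhere zero p = p []
everywhere (suc n) p = everywhere n (p ∘ (false ∷_)) ∧ everywhere n (p ∘ (true ∷_))

everywhere-sound : (p : Vec Bool n → Bool) → everywhere n p ≡ true → ∀ v → p v ≡ true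
everywhere-sound p ok [] = ok
everywhere-sound {suc n} p ok (a ∷ v) with everywhere n (p ∘ (false ∷_)) in okᶠ
everywhere-sound p ok (false ∷ v) | true = everywhere-sound (p ∘ (false ∷_)) okᶠ v
everywhere-sound p ok (true ∷ v) | true = everywhere-sound (p ∘ (true ∷_)) ok v

-- Tuples with repeated or wrongly ordered vertices count as successes in the check; `unless` and
-- `when` strip these guards for tuples that satisfy the conditions.
unless : {A : Set} (d : Dec A) {r : Bool} → does d ∨ r ≡ true → ¬ A → r ≡ true
unless (no _) ok _ = ok
unless (yes a) _ ¬a = contradiction a ¬a

when : {b r : Bool} → not b ∨ r ≡ true → T b → r ≡ true
when {true} ok _ = ok

origin : Vec Bool n
origin = Vec.replicate _ false

infix 4 _≤ˡᵉˣ_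
_≤ˡᵉˣ_ : Vec Bool n → Vec Bool n → Bool
[] ≤ˡᵉˣ [] = true
(false ∷ u) ≤ˡᵉˣ (false ∷ v) = u ≤ˡᵉˣ v
(false ∷ u) ≤ˡᵉˣ (true ∷ v) = true
(true ∷ u) ≤ˡᵉˣ (false ∷ v) = false
(true ∷ u) ≤ˡᵉˣ (true ∷ v) = u ≤ˡᵉˣ v

≤ˡᵉˣ-total : (u v : Vec Bool n) → T (u ≤ˡᵉˣ v) ⊎ T (v ≤ˡᵉˣ u)
≤ˡᵉˣ-total [] [] = inj₁ tt
≤ˡᵉˣ-total (false ∷ u) (false ∷ v) = ≤ˡᵉˣ-total u v
≤ˡᵉˣ-total (false ∷ u) (true ∷ v) = inj₁ tt
≤ˡᵉˣ-total (true ∷ u) (false ∷ v) = inj₂ tt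
≤ˡᵉˣ-total (true ∷ u) (true ∷ v) = ≤ˡᵉˣ-total u v

-- Up to translation the unpaired terminal is the origin; ordering the ends of each pair
-- quarters the search.
searchPairs completes₃ : (s₁ t₁ s₂ t₂ : Vec Bool 4) → Bool
searchPairs s₁ t₁ s₂ t₂ = search 4 s₁ t₁ (origin ∷ s₁ ∷ t₁ ∷ s₂ ∷ t₂ ∷ []) λ B → search 4 s₂ t₂ B λ _ → true
completes₃ s₁ t₁ s₂ t₂ = not (s₂ ≤ˡᵉˣ t₂) ∨ does (t₂ ∈? (origin ∷ s₁ ∷ t₁ ∷ s₂ ∷ [])) ∨ searchPairs s₁ t₁ s₂ t₂

completes₂ : (s₁ t₁ s₂ : Vec Bool 4) → Bool
completes₂ s₁ t₁ s₂ = does (s₂ ∈? (origin ∷ s₁ ∷ t₁ ∷ [])) ∨ everywhere 4 (completes₃ s₁ t₁ s₂)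

completes₁ : (s₁ t₁ : Vec Bool 4) → Bool
completes₁ s₁ t₁ = not (s₁ ≤ˡᵉˣ t₁) ∨ does (t₁ ∈? (origin ∷ s₁ ∷ [])) ∨ everywhere 4 (completes₂ s₁ t₁)

completes₀ : (s₁ : Vec Bool 4) → Bool
completes₀ s₁ = does (s₁ ∈? (origin ∷ [])) ∨ everywhere 4 (completes₁ s₁)

-- Evaluation runs the whole search. It also confirms that four inner vertices per walk suffice,
-- even though the search takes the direct edge whenever there is one.
completes₀-true : everywhere 4 completes₀ ≡ true
completes₀-true = refl

-- With all terminals in `B`, disjointness needs to be stated for inner vertices only.
record TwoWalks (s₁ t₁ s₂ t₂ : Vec Bool n) (B : List (Vec Bool n)) : Set where
  field
    inner₁ inner₂ : List (Vec Bool n)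
    walk₁ : WalkIn (s₁ ∷ t₁ ∷ inner₁) s₁ t₁
    walk₂ : WalkIn (s₂ ∷ t₂ ∷ inner₂) s₂ t₂
    avoids₁ : ∀ {v} → v ∈ inner₁ → v ∉ B
    avoids₂ : ∀ {v} → v ∈ inner₂ → v ∉ B
    disjoint : ∀ {v} → v ∈ inner₂ → v ∉ inner₁

-- Abstract, as unfolding it would repeat the search.
abstract
  twoWalks : (s₁ t₁ s₂ t₂ : Vec Bool 4) → T (s₁ ≤ˡᵉˣ t₁) → T (s₂ ≤ˡᵉˣ t₂) →
    s₁ ∉ origin ∷ [] → t₁ ∉ origin ∷ s₁ ∷ [] →
    s₂ ∉ origin ∷ s₁ ∷ t₁ ∷ [] → t₂ ∉ origin ∷ s₁ ∷ t₁ ∷ s₂ ∷ [] →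
    TwoWalks s₁ t₁ s₂ t₂ (origin ∷ s₁ ∷ t₁ ∷ s₂ ∷ t₂ ∷ [])
  twoWalks s₁ t₁ s₂ t₂ s₁≤t₁ s₂≤t₂ s₁∉ t₁∉ s₂∉ t₂∉ = record
    { inner₁ = F₁.inner ; inner₂ = F₂.inner ; walk₁ = F₁.walk ; walk₂ = F₂.walk
    ; avoids₁ = F₁.avoids
    ; avoids₂ = λ v∈ → F₂.avoids v∈ ∘ F₁.B⊆rest
    ; disjoint = λ v∈ → F₂.avoids v∈ ∘ F₁.inner⊆rest }
    where
    ok₀ : everywhere 4 (completes₁ s₁) ≡ true
    ok₀ = unless (s₁ ∈? (origin ∷ [])) (everywhere-sound completes₀ completes₀-true s₁) s₁∉
    ok₁ : everywhere 4 (completes₂ s₁ t₁) ≡ true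
    ok₁ = unless (t₁ ∈? (origin ∷ s₁ ∷ [])) (when (everywhere-sound (completes₁ s₁) ok₀ t₁) s₁≤t₁) t₁∉
    ok₂ : everywhere 4 (completes₃ s₁ t₁ s₂) ≡ true
    ok₂ = unless (s₂ ∈? (origin ∷ s₁ ∷ t₁ ∷ [])) (everywhere-sound (completes₂ s₁ t₁) ok₁ s₂) s₂∉
    ok₃ : searchPairs s₁ t₁ s₂ t₂ ≡ true
    ok₃ = unless (t₂ ∈? (origin ∷ s₁ ∷ t₁ ∷ s₂ ∷ []))
      (when (everywhere-sound (completes₃ s₁ t₁ s₂) ok₂ t₂) s₂≤t₂) t₂∉
    terminals : List (Vec Bool 4)
    terminals = origin ∷ s₁ ∷ t₁ ∷ s₂ ∷ t₂ ∷ []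
    module F₁ = Found (search-sound 4 s₁ t₁ terminals (λ B → search 4 s₂ t₂ B λ _ → true)
      (subst T (sym ok₃) tt))
    module F₂ = Found (search-sound 4 s₂ t₂ F₁.rest (λ _ → true) F₁.continue)

-- Translations, and the five terminals as two pairs and a single one

_⊕_ : Vec Bool n → Vec Bool n → Vec Bool n
_⊕_ = Vec.zipWith _xor_

⊕-self : (a : Vec Bool n) → a ⊕ a ≡ origin
⊕-self [] = refl
⊕-self (a ∷ as) = cong₂ _∷_ (Bool.xor-same a) (⊕-self as)

⊕-involutive : (a v : Vec Bool n) → a ⊕ (a ⊕ v) ≡ v
⊕-involutive [] [] = refl
⊕-involutive (a ∷ as) (b ∷ v) = cong₂ _∷_
  (trans (sym (Bool.xor-assoc a a b)) (cong (_xor b) (Bool.xor-same a))) (⊕-involutive as v)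

hamming-⊕ : (a u v : Vec Bool n) → hamming (a ⊕ u) (a ⊕ v) ≡ hamming u v
hamming-⊕ [] [] [] = refl
hamming-⊕ (true ∷ a) (true ∷ u) (true ∷ v) = hamming-⊕ a u v
hamming-⊕ (true ∷ a) (true ∷ u) (false ∷ v) = cong suc (hamming-⊕ a u v)
hamming-⊕ (true ∷ a) (false ∷ u) (true ∷ v) = cong suc (hamming-⊕ a u v)
hamming-⊕ (true ∷ a) (false ∷ u) (false ∷ v) = hamming-⊕ a u v
hamming-⊕ (false ∷ a) (true ∷ u) (true ∷ v) = hamming-⊕ a u v
hamming-⊕ (false ∷ a) (true ∷ u) (false ∷ v) = cong suc (hamming-⊕ a u v)
hamming-⊕ (false ∷ a) (false ∷ u) (true ∷ v) = cong suc (hamming-⊕ a u v)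
hamming-⊕ (false ∷ a) (false ∷ u) (false ∷ v) = hamming-⊕ a u v

⊕-injective : (a : Vec Bool n) {u v : Vec Bool n} → a ⊕ u ≡ a ⊕ v → u ≡ v
⊕-injective a {u} {v} e = trans (sym (⊕-involutive a u)) (trans (cong (a ⊕_) e) (⊕-involutive a v))

-- Translation by `a` is an involutive automorphism of the cube, so a colouring can be pulled back
-- along it.
linkable-⊕ : {I : Set} {x : I → Vec Bool n} {col : I → ℕ} (a : Vec Bool n) →
  Linkable ((a ⊕_) ∘ x) col → Linkable x col
linkable-⊕ {x = x} a (c , ext , conn) = c ∘ (a ⊕_) , ext , λ p q e →
  subst₂ (Mono (c ∘ (a ⊕_)) _) (⊕-involutive a (x p)) (⊕-involutive a (x q))
    (gmap (a ⊕_) (λ {u} {v} (adj , cu , cv) → trans (hamming-⊕ a u v) adj ,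
      trans (cong c (⊕-involutive a u)) cu , trans (cong c (⊕-involutive a v)) cv) (conn p q e))

-- Either `p` and `q` are a pair of one colour, or each is alone in its colour. Admitting the second
-- case lets unpaired terminals be treated as if they were paired.
record PairSplit (col : Fin (2 + m) → ℕ) : Set where
  field
    p q : Fin (2 + m)
    others : Fin m → Fin (2 + m)
    p≢q : p ≢ q
    others≢p : ∀ k → others k ≢ p
    others≢q : ∀ k → others k ≢ q
    others-injective : Injective _≡_ _≡_ others
    cover : ∀ r → r ≡ p ⊎ r ≡ q ⊎ ∃ λ k → r ≡ others k
    colour≢p : ∀ k → col (others k) ≢ col p
    colour≢q : ∀ k → col (others k) ≢ col q

  swap : PairSplit col
  swap = record
    { p = q ; q = p ; others = others ; p≢q = p≢q ∘ sym ; others≢p = others≢q ; others≢q = others≢p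
    ; others-injective = others-injective
    ; cover = λ r → [ inj₂ ∘ inj₁ , [ inj₁ , inj₂ ∘ inj₂ ]′ ]′ (cover r)
    ; colour≢p = colour≢q ; colour≢q = colour≢p }

  -- No colour is shared between the two chosen terminals and the others, so mixed cases are void.
  -- Applied twice, this reduces five terminals to two pairs and a single one.
  fromPairSplit : (R : Fin (2 + m) → Fin (2 + m) → Set) →
    (∀ {r} → R r r) → (∀ {r s} → col r ≡ col s → R r s → R s r) →
    (col p ≡ col q → R p q) → (∀ k l → col (others k) ≡ col (others l) → R (others k) (others l)) →
    ∀ r s → col r ≡ col s → R r s
  fromPairSplit R reflexive symmetric Rpq Rothers r s e with cover r | cover s
  ... | inj₁ refl | inj₁ refl = reflexive
  ... | inj₁ refl | inj₂ (inj₁ refl) = Rpq e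
  ... | inj₁ refl | inj₂ (inj₂ (k , refl)) = contradiction (sym e) (colour≢p k)
  ... | inj₂ (inj₁ refl) | inj₁ refl = symmetric (sym e) (Rpq (sym e))
  ... | inj₂ (inj₁ refl) | inj₂ (inj₁ refl) = reflexive
  ... | inj₂ (inj₁ refl) | inj₂ (inj₂ (k , refl)) = contradiction (sym e) (colour≢q k)
  ... | inj₂ (inj₂ (k , refl)) | inj₁ refl = contradiction e (colour≢p k)
  ... | inj₂ (inj₂ (k , refl)) | inj₂ (inj₁ refl) = contradiction e (colour≢q k)
  ... | inj₂ (inj₂ (k , refl)) | inj₂ (inj₂ (l , refl)) = Rothers k l e

pairSplitAt : {col : Fin (2 + m) → ℕ} (p : Fin (2 + m)) (q : Fin (suc m)) →
  (∀ k → col (punchIn p (punchIn q k)) ≢ col p × col (punchIn p (punchIn q k)) ≢ col (punchIn p q)) →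
  PairSplit col
pairSplitAt {m} p q ne = record
  { p = p ; q = punchIn p q ; others = others ; p≢q = punchInᵢ≢i p q ∘ sym
  ; others≢p = λ k → punchInᵢ≢i p _
  ; others≢q = λ k e → punchInᵢ≢i q k (punchIn-injective p _ _ e)
  ; others-injective = λ e → punchIn-injective q _ _ (punchIn-injective p _ _ e)
  ; cover = cover
  ; colour≢p = proj₁ ∘ ne ; colour≢q = proj₂ ∘ ne }
  where
  others : Fin m → Fin (2 + m)
  others = punchIn p ∘ punchIn q
  cover : ∀ r → r ≡ p ⊎ r ≡ punchIn p q ⊎ ∃ λ k → r ≡ others k
  cover r with p Fin.≟ r
  ... | yes refl = inj₁ refl
  ... | no p≢r with q Fin.≟ punchOut p≢r
  ... | yes refl = inj₂ (inj₁ (sym (punchIn-punchOut p≢r)))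
  ... | no q≢ = inj₂ (inj₂ (punchOut q≢ ,
          trans (sym (punchIn-punchOut p≢r)) (cong (punchIn p) (sym (punchIn-punchOut q≢)))))

-- Two terminals of equal colour exhaust that colour; if there are none, any two terminals will do.
pairSplit : {lab : Fin (2 + m) → ℕ × Bool} → Injective _≡_ _≡_ lab → PairSplit (proj₁ ∘ lab)
pairSplit {lab = lab} lab-inj
  with any? (λ p → any? λ q → proj₁ (lab p) ℕ.≟ proj₁ (lab (punchIn p q)))
... | yes (p , q , e) = pairSplitAt p q λ k →
        (λ f → unique p q k e (sym f)) , (λ f → unique p q k e (trans e (sym f)))
  where
  unique : ∀ p q k → proj₁ (lab p) ≡ proj₁ (lab (punchIn p q)) →
    proj₁ (lab p) ≢ proj₁ (lab (punchIn p (punchIn q k)))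
  unique p q k = noThreeOfAColour lab-inj (punchInᵢ≢i p q ∘ sym) (punchInᵢ≢i p (punchIn q k) ∘ sym)
    (punchInᵢ≢i q k ∘ sym ∘ punchIn-injective p _ _)
... | no none = pairSplitAt zero zero λ k →
        (λ f → none (zero , suc k , sym f)) , (λ f → none (suc zero , suc k , sym f))

-- The search joins both chosen pairs whether or not their colours agree; where they differ, the
-- walk is simply not called upon. Inner vertices take the colour of the start of their walk.
linkableFromOrigin : (x : Fin 5 → Vec Bool 4) (lab : Fin 5 → ℕ × Bool) →
  Injective _≡_ _≡_ x → Injective _≡_ _≡_ lab → (S : PairSplit (proj₁ ∘ lab)) →
  T (x (PairSplit.p S) ≤ˡᵉˣ x (PairSplit.q S)) → (S′ : PairSplit (proj₁ ∘ lab ∘ PairSplit.others S)) →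
  T (x (PairSplit.others S (PairSplit.p S′)) ≤ˡᵉˣ x (PairSplit.others S (PairSplit.q S′))) →
  x (PairSplit.others S (PairSplit.others S′ zero)) ≡ origin → Linkable x (proj₁ ∘ lab)
linkableFromOrigin x lab x-inj lab-inj S s₁≤t₁ S′ s₂≤t₂ u≡origin = c , ext , conn
  where
  module S = PairSplit S
  module S′ = PairSplit S′
  col : Fin 5 → ℕ
  col = proj₁ ∘ lab
  s₁ t₁ s₂ t₂ u : Fin 5
  s₁ = S.p
  t₁ = S.q
  s₂ = S.others S′.p
  t₂ = S.others S′.q
  u = S.others (S′.others zero)
  x≢ : ∀ {a b} → a ≢ b → x a ≢ x b
  x≢ a≢b = a≢b ∘ x-inj
  ≢origin : ∀ {a} → a ≢ u → x a ≢ origin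
  ≢origin a≢u e = a≢u (x-inj (trans e (sym u≡origin)))
  terminals : List (Vec Bool 4)
  terminals = origin ∷ x s₁ ∷ x t₁ ∷ x s₂ ∷ x t₂ ∷ []
  walks : TwoWalks (x s₁) (x t₁) (x s₂) (x t₂) terminals
  walks = twoWalks (x s₁) (x t₁) (x s₂) (x t₂) s₁≤t₁ s₂≤t₂
    (λ { (here e) → ≢origin (S.others≢p _ ∘ sym) e })
    (λ { (here e) → ≢origin (S.others≢q _ ∘ sym) e
       ; (there (here e)) → x≢ (S.p≢q ∘ sym) e })
    (λ { (here e) → ≢origin (S′.others≢p _ ∘ sym ∘ S.others-injective) e
       ; (there (here e)) → x≢ (S.others≢p _) e
       ; (there (there (here e))) → x≢ (S.others≢q _) e })
    (λ { (here e) → ≢origin (S′.others≢q _ ∘ sym ∘ S.others-injective) e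
       ; (there (here e)) → x≢ (S.others≢p _) e
       ; (there (there (here e))) → x≢ (S.others≢q _) e
       ; (there (there (there (here e)))) → x≢ (S′.p≢q ∘ sym ∘ S.others-injective) e })
  open TwoWalks walks
  terminal : ∀ r → x r ∈ terminals
  terminal r with S.cover r
  ... | inj₁ refl = there (here refl)
  ... | inj₂ (inj₁ refl) = there (there (here refl))
  ... | inj₂ (inj₂ (k , refl)) with S′.cover k
  ... | inj₁ refl = there (there (there (here refl)))
  ... | inj₂ (inj₁ refl) = there (there (there (there (here refl))))
  ... | inj₂ (inj₂ (zero , refl)) = here u≡origin
  c : Vec Bool 4 → ℕ
  c v with v ∈? inner₁ | v ∈? inner₂ | any? (λ r → x r ≟ⱽ v)
  ... | yes _ | _ | _ = col s₁
  ... | no _ | yes _ | _ = col s₂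
  ... | no _ | no _ | yes (r , _) = col r
  -- An arbitrary colour: no chosen walk visits such a vertex, so a clash with a colour in use does
  -- no harm.
  ... | no _ | no _ | no _ = 0
  ext : ∀ r → c (x r) ≡ col r
  ext r with x r ∈? inner₁ | x r ∈? inner₂ | any? (λ s → x s ≟ⱽ x r)
  ... | yes v∈ | _ | _ = contradiction (terminal r) (avoids₁ v∈)
  ... | no _ | yes v∈ | _ = contradiction (terminal r) (avoids₂ v∈)
  ... | no _ | no _ | yes (s , e) = cong col (x-inj e)
  ... | no _ | no _ | no none = contradiction (r , refl) none
  c-inner₁ : ∀ {v} → v ∈ inner₁ → c v ≡ col s₁
  c-inner₁ {v} v∈ with v ∈? inner₁
  ... | yes _ = refl
  ... | no v∉ = contradiction v∈ v∉
  c-inner₂ : ∀ {v} → v ∈ inner₂ → c v ≡ col s₂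
  c-inner₂ {v} v∈ with v ∈? inner₁ | v ∈? inner₂
  ... | yes v∈₁ | _ = contradiction v∈₁ (disjoint v∈)
  ... | no _ | yes _ = refl
  ... | no _ | no v∉ = contradiction v∈ v∉
  colourWalk : ∀ {s t inner} → col s ≡ col t → (∀ {v} → v ∈ inner → c v ≡ col s) →
    WalkIn (x s ∷ x t ∷ inner) (x s) (x t) → Mono c (col s) (x s) (x t)
  colourWalk {s} {t} {inner} e c-inner = gmap (λ v → v) λ (adj , a , b) → adj , c-walk a , c-walk b
    where
    c-walk : ∀ {v} → v ∈ x s ∷ x t ∷ inner → c v ≡ col s
    c-walk (here refl) = ext s
    c-walk (there (here refl)) = trans (ext t) (sym e)
    c-walk (there (there v∈)) = c-inner v∈
  Joined : Fin 5 → Fin 5 → Set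
  Joined r s = Mono c (col r) (x r) (x s)
  joined-sym : ∀ {r s} → col r ≡ col s → Joined r s → Joined s r
  joined-sym {r} {s} e w = subst (λ γ → Mono c γ (x s) (x r)) e (Mono-sym w)
  conn : ∀ r s → col r ≡ col s → Joined r s
  conn = S.fromPairSplit Joined ε joined-sym (λ e → colourWalk e c-inner₁ walk₁)
    (S′.fromPairSplit (λ k l → Joined (S.others k) (S.others l)) ε joined-sym
      (λ e → colourWalk e c-inner₂ walk₂) λ { zero zero _ → ε })

-- Translation moves the single terminal to the origin, and swapping ends brings each pair into the
-- order searched. Dimension 3 could not be the base: the 3-cube graph is planar, so the two
-- diagonal pairs of a square face cannot be linked disjointly.
alwaysLinkable₄ : AlwaysLinkable 4
alwaysLinkable₄ x lab x-inj lab-inj = linkable-⊕ a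
    (orient (≤ˡᵉˣ-total (y S.p) (y S.q)) (≤ˡᵉˣ-total (y (S.others S′.p)) (y (S.others S′.q))))
  where
  S : PairSplit (proj₁ ∘ lab)
  S = pairSplit lab-inj
  module S = PairSplit S
  S′ : PairSplit (proj₁ ∘ lab ∘ S.others)
  S′ = pairSplit (S.others-injective ∘ lab-inj)
  module S′ = PairSplit S′
  a : Vec Bool 4
  a = x (S.others (S′.others zero))
  y : Fin 5 → Vec Bool 4
  y = (a ⊕_) ∘ x
  link = linkableFromOrigin y lab (x-inj ∘ ⊕-injective a) lab-inj
  orient : T (y S.p ≤ˡᵉˣ y S.q) ⊎ T (y S.q ≤ˡᵉˣ y S.p) →
    T (y (S.others S′.p) ≤ˡᵉˣ y (S.others S′.q)) ⊎ T (y (S.others S′.q) ≤ˡᵉˣ y (S.others S′.p)) →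
    Linkable y (proj₁ ∘ lab)
  orient (inj₁ le) (inj₁ le′) = link S le S′ le′ (⊕-self a)
  orient (inj₁ le) (inj₂ le′) = link S le S′.swap le′ (⊕-self a)
  orient (inj₂ le) (inj₁ le′) = link S.swap le S′ le′ (⊕-self a)
  orient (inj₂ le) (inj₂ le′) = link S.swap le S′.swap le′ (⊕-self a)

alwaysLinkable₄₊ : ∀ k → AlwaysLinkable (4 + k)
alwaysLinkable₄₊ zero = alwaysLinkable₄
alwaysLinkable₄₊ (suc k) = alwaysLinkable-step (s≤s (s≤s (s≤s z≤n))) (alwaysLinkable₄₊ k)

-- From colourings to paths

module _ {P : Vec Bool n → Set} where

  private
    Path : Vec Bool n → Vec Bool n → Set
    Path u v = ∃ λ vs → IsPath (CubeAdj n) u v vs × All P vs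

  pathFrom : ∀ {u w v vs} → u ∈ vs → Walk (CubeAdj n) w v vs → Unique vs → All P vs → Path u v
  pathFrom (here refl) (stop v) uniq ps = _ , (stop v , uniq) , ps
  pathFrom (here refl) (step e w) uniq ps = _ , (step e w , uniq) , ps
  pathFrom (there u∈) (step e w) (_ ∷ uniq) (_ ∷ ps) = pathFrom u∈ w uniq ps

  -- If the path already built from the second vertex returns to `u`, its part from `u` on is kept;
  -- otherwise `u` is prepended. `P v` is a separate argument because an empty walk says nothing
  -- about its vertex.
  loopErase : ∀ {u v} → P v → Star (λ a b → CubeAdj n a b × P a × P b) u v → Path u v
  loopErase pv ε = _ , (stop _ , [] ∷ []) , pv ∷ []
  loopErase {u} pv ((e , pu , _) ◅ w) with loopErase pv w
  ... | vs , (w′ , uniq) , ps with u ∈? vs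
  ... | yes u∈ = pathFrom u∈ w′ uniq ps
  ... | no u∉ = u ∷ vs , (step e w′ , ¬Any⇒All¬ vs u∉ ∷ uniq) , pu ∷ ps

-- The origin and the `d` unit vectors.
distinctVertices : ∀ d → Fin (suc d) → Vec Bool d
distinctVertices d zero = origin
distinctVertices (suc d) (suc zero) = true ∷ origin
distinctVertices (suc d) (suc (suc i)) = false ∷ distinctVertices d (suc i)

distinctVertices-≢origin : ∀ d i → distinctVertices d (suc i) ≢ origin
distinctVertices-≢origin (suc d) (suc i) = distinctVertices-≢origin d i ∘ ∷-injectiveʳ

distinctVertices-injective : ∀ d → Injective _≡_ _≡_ (distinctVertices d)
distinctVertices-injective d {zero} {zero} _ = refl
distinctVertices-injective d {zero} {suc j} e = contradiction (sym e) (distinctVertices-≢origin d j)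
distinctVertices-injective d {suc i} {zero} e = contradiction e (distinctVertices-≢origin d i)
distinctVertices-injective (suc d) {suc zero} {suc zero} _ = refl
distinctVertices-injective (suc d) {suc (suc i)} {suc (suc j)} e =
  cong suc (distinctVertices-injective d (∷-injectiveʳ e))

-- Labels from a pairing

module Labelling (s t : Fin n → Fin m) (s-inj : Injective _≡_ _≡_ s) (t-inj : Injective _≡_ _≡_ t)
  (s≢t : ∀ i j → s i ≢ t j) where

  -- Pairs use the colours below `n`; the shift by `n` gives every unpaired terminal a colour of its
  -- own.
  data Labelled (p : Fin m) : ℕ × Bool → Set where
    source : ∀ i → p ≡ s i → Labelled p (toℕ i , false)
    target : ∀ i → p ≡ t i → Labelled p (toℕ i , true)
    unpaired : (∀ i → p ≢ s i) → (∀ i → p ≢ t i) → Labelled p (n + toℕ p , false)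

  labelled : ∀ p → ∃ (Labelled p)
  labelled p with any? (λ i → p Fin.≟ s i) | any? (λ i → p Fin.≟ t i)
  ... | yes (i , e) | _ = _ , source i e
  ... | no _ | yes (i , e) = _ , target i e
  ... | no ¬s | no ¬t = _ , unpaired (λ i e → ¬s (i , e)) (λ i e → ¬t (i , e))

  label : Fin m → ℕ × Bool
  label = proj₁ ∘ labelled

  toℕ≢n+ : (i : Fin n) {k : ℕ} → toℕ i ≢ n + k
  toℕ≢n+ i {k} = ℕ.<⇒≢ (ℕ.<-≤-trans (Fin.toℕ<n i) (ℕ.m≤m+n n k))

  label-injective : Injective _≡_ _≡_ label
  label-injective {p} {q} eq with labelled p | labelled q
  ... | _ , source i e | _ , source j f with refl ← Fin.toℕ-injective (cong proj₁ eq) = trans e (sym f)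
  ... | _ , target i e | _ , target j f with refl ← Fin.toℕ-injective (cong proj₁ eq) = trans e (sym f)
  ... | _ , source i _ | _ , unpaired _ _ = contradiction (cong proj₁ eq) (toℕ≢n+ i)
  ... | _ , unpaired _ _ | _ , source j _ = contradiction (sym (cong proj₁ eq)) (toℕ≢n+ j)
  ... | _ , unpaired _ _ | _ , unpaired _ _ = Fin.toℕ-injective (ℕ.+-cancelˡ-≡ n _ _ (cong proj₁ eq))
  ... | _ , source _ _ | _ , target _ _ = contradiction (cong proj₂ eq) λ ()
  ... | _ , target _ _ | _ , source _ _ = contradiction (cong proj₂ eq) λ ()
  ... | _ , target _ _ | _ , unpaired _ _ = contradiction (cong proj₂ eq) λ ()
  ... | _ , unpaired _ _ | _ , target _ _ = contradiction (cong proj₂ eq) λ ()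

  colour-source : ∀ i → proj₁ (label (s i)) ≡ toℕ i
  colour-source i with labelled (s i)
  ... | _ , source j e = cong toℕ (s-inj (sym e))
  ... | _ , target j e = contradiction e (s≢t i j)
  ... | _ , unpaired ¬s _ = contradiction refl (¬s i)

  colour-target : ∀ i → proj₁ (label (t i)) ≡ toℕ i
  colour-target i with labelled (t i)
  ... | _ , source j e = contradiction (sym e) (s≢t j i)
  ... | _ , target j e = cong toℕ (t-inj (sym e))
  ... | _ , unpaired _ ¬t = contradiction refl (¬t i)

  colour-unpaired : ∀ {p} → (∀ i → p ≢ s i) → (∀ i → p ≢ t i) → proj₁ (label p) ≡ n + toℕ p
  colour-unpaired {p} ¬s ¬t with labelled p
  ... | _ , source j e = contradiction e (¬s j)
  ... | _ , target j e = contradiction e (¬t j)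
  ... | _ , unpaired _ _ = refl

-- The path of the pair `i` stays in the colour `toℕ i`. Different paths are therefore disjoint, and
-- unpaired terminals, whose colours are larger, lie on none of them.
stronglyLinked : ∀ d → AlwaysLinkable d → StronglyLinked (CubeAdj d) d
stronglyLinked d linkable = (distinctVertices d , distinctVertices-injective d) , link
  where
  link : (x : Fin (suc d) → Vec Bool d) → Injective _≡_ _≡_ x → (s t : Fin ⌊ suc d /2⌋ → Fin (suc d)) →
    Injective _≡_ _≡_ s → Injective _≡_ _≡_ t → (∀ i j → s i ≢ t j) → _
  link x x-inj s t s-inj t-inj s≢t = (λ i → proj₁ (path i)) , (λ i → proj₁ (proj₂ (path i))) ,
      (λ i j i≢j v v∈ v∈′ → i≢j (Fin.toℕ-injective (trans (sym (colour i v∈)) (colour j v∈′)))) ,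
      (λ i p ¬s ¬t p∈ → toℕ≢n+ i (trans (sym (colour i p∈)) (trans (ext p) (colour-unpaired ¬s ¬t))))
    where
    open Labelling s t s-inj t-inj s≢t
    colouring = linkable x label x-inj label-injective
    c = proj₁ colouring
    ext = proj₁ (proj₂ colouring)
    path : ∀ i → ∃ λ vs → IsPath (CubeAdj d) (x (s i)) (x (t i)) vs × All (λ v → c v ≡ toℕ i) vs
    path i = loopErase (trans (ext (t i)) (colour-target i))
      (subst (λ γ → Mono c γ (x (s i)) (x (t i))) (colour-source i)
        (proj₂ (proj₂ colouring) (s i) (t i) (trans (colour-source i) (sym (colour-target i)))))
    colour : ∀ i {v} → v ∈ proj₁ (path i) → c v ≡ toℕ i
    colour i = All.lookup (proj₂ (proj₂ (path i)))

theorem28 : (d : ℕ) → 1 ≤ d → d ≢ 3 → StronglyLinked {V = Vec Bool d} (CubeAdj d) d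
theorem28 1 _ _ = stronglyLinked 1 alwaysLinkable₁
theorem28 2 _ _ = stronglyLinked 2 alwaysLinkable₂
theorem28 3 _ d≢3 = contradiction refl d≢3
theorem28 (suc (suc (suc (suc k)))) _ _ = stronglyLinked (4 + k) (alwaysLinkable₄₊ k)
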